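{- For $h\ge0$ let $\mathcal{P}_h(X)=\sum_{L\ge0}p(L,h)X^L$ (formal power series). Then $\mathcal{P}_0(X)=\dfrac{1}{1-X}$, $\mathcal{P}_1(X)=\dfrac{X}{1-X^2}$, and for all $h\ge2$, $$\mathcal{P}_h(X)=\frac{1}{1-X^{h+1}}\left(\sum_{L=0}^{h-1}p(L,h)X^L+\frac{X^h}{1-X^{h-1}}\sum_{r=0}^{h-2}p(h-1,r)X^r\right).$$
   Context: For a finite word $w$ over $\{0,1\}$, $|w|$ is its length and $|w|_0,|w|_1$ are its numbers of $0$'s and $1$'s; $|w|_1$ is the height of $w$. A subword means a contiguous factor. A word $w$ is balanced if for all finite subwords $u,v$ of $w$ with $|u|=|v|$ one has $\bigl||u|_0-|v|_0\bigr|\le 1$. For $0\le h\le L$, $\mathbb{P}(L,h)$ is the set of balanced palindromes in $\{0,1\}^*$ of length $L$ and height $h$. The function $p:\mathbb{Z}^2\to\mathbb{N}$ is defined by $p(L,h)=\#\mathbb{P}(L,h\bmod L)$ if $L>0$ (with $h\bmod L\in\{0,\dots,L-1\}$), $p(0,0)=1$, and $p(L,h)=0$ if $L<0$ or if $L=0$ and $h\ne0$. -}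

module Defs where

open import Algebra.Bundles using (CommutativeMonoid; RawRing)
import Algebra.Construct.Pointwise as Pointwise
import Algebra.Definitions.RawSemiring as RawSemiringDefinitions
import Algebra.Properties.Monoid.Sum as MonoidSum
open import Data.Fin as Fin using (Fin; toℕ)
open import Data.Fin.Patterns using (0F; 1F)
open import Data.Integer as ℤ using (ℤ; +_; -[1+_]; 0ℤ; 1ℤ; _%ℕ_)
import Data.Integer.Properties as ℤ
open import Data.List
  using (List; []; _∷_; [_]; length; filter; reverse; _++_; inits;
         allFin; cartesianProductWith)
open import Data.List.Membership.Propositional using (_∈_)
open import Data.List.Membership.Propositional.Properties
  using (∈-map⁺; ∈-map⁻; ∈-++⁺ˡ; ∈-++⁺ʳ; ∈-++⁻; ∈-allFin; ∈-filter⁺; ∈-filter⁻;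
         ∈-cartesianProductWith⁺)
open import Data.List.Properties using (∷-injective; ≡-dec)
open import Data.List.Relation.Binary.Infix.Heterogeneous using (Infix; here; there)
open import Data.List.Relation.Binary.Prefix.Heterogeneous using (Prefix; []; _∷_)
open import Data.List.Relation.Unary.All as All using ()
open import Data.List.Relation.Unary.Any using (here; there)
open import Data.List.Relation.Unary.Unique.Propositional using (Unique)
import Data.List.Relation.Unary.AllPairs as AllPairs
import Data.List.Relation.Unary.Unique.Propositional.Properties as Unique
open import Data.Nat as ℕ using (ℕ; zero; suc; _≤_; _∸_; ∣_-_∣)
open import Data.Product using (_×_; _,_; proj₁; proj₂)
open import Data.Sum using (inj₁; inj₂)
open import Data.Vec as Vec using (Vec; []; _∷_)
open import Function using (_⇔_; mk⇔)
open import Relation.Binary.PropositionalEquality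
  using (_≡_; refl; sym; trans; cong; subst)
open import Relation.Nullary.Decidable using (map′; _×-dec_; _→-dec_)
open import Relation.Unary using (Decidable)

Word : Set
Word = List (Fin 2)

infix 8 ∣_∣[_]

∣_∣[_] : Word → Fin 2 → ℕ
∣ w ∣[ a ] = length (filter (a Fin.≟_) w)

height : Word → ℕ
height w = ∣ w ∣[ 1F ]

infix 4 _⊑_

_⊑_ : Word → Word → Set
u ⊑ w = Infix _≡_ u w

Balanced : Word → Set
Balanced w = ∀ u v → u ⊑ w → v ⊑ w → length u ≡ length v →
             ∣ ∣ u ∣[ 0F ] - ∣ v ∣[ 0F ] ∣ ≤ 1

Palindrome : Word → Set
Palindrome w = reverse w ≡ w

ℙ : ℕ → ℕ → Word → Set
ℙ L h w = length w ≡ L × height w ≡ h × Balanced w × Palindrome w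

subwords : Word → List Word
subwords []      = [ [] ]
subwords (a ∷ w) = inits (a ∷ w) ++ subwords w

private
  prefix⇒∈inits : ∀ {u w : Word} → Prefix _≡_ u w → u ∈ inits w
  prefix⇒∈inits {w = []}    []         = here refl
  prefix⇒∈inits {w = _ ∷ _} []         = here refl
  prefix⇒∈inits {w = a ∷ w} (refl ∷ p) = there (∈-map⁺ (a ∷_) (prefix⇒∈inits p))

  ∈inits⇒prefix : ∀ {u : Word} w → u ∈ inits w → Prefix _≡_ u w
  ∈inits⇒prefix w       (here refl) = []
  ∈inits⇒prefix (a ∷ w) (there u∈)
    with _ , u′∈ , refl ← ∈-map⁻ (a ∷_) {xs = inits w} u∈ =
    refl ∷ ∈inits⇒prefix w u′∈

⊑⇒∈subwords : ∀ {u w} → u ⊑ w → u ∈ subwords w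
⊑⇒∈subwords {w = []}    (here [])  = here refl
⊑⇒∈subwords {w = _ ∷ _} (here p)   = ∈-++⁺ˡ (prefix⇒∈inits p)
⊑⇒∈subwords {w = a ∷ w} (there u⊑) = ∈-++⁺ʳ (inits (a ∷ w)) (⊑⇒∈subwords u⊑)

∈subwords⇒⊑ : ∀ {u} w → u ∈ subwords w → u ⊑ w
∈subwords⇒⊑ []      (here refl) = here []
∈subwords⇒⊑ (a ∷ w) u∈ with ∈-++⁻ (inits (a ∷ w)) u∈
... | inj₁ u∈inits = here (∈inits⇒prefix (a ∷ w) u∈inits)
... | inj₂ u∈rest  = there (∈subwords⇒⊑ w u∈rest)

balanced? : Decidable Balanced
balanced? w = map′
  (λ b u v u⊑w v⊑w →
     All.lookup (All.lookup b (⊑⇒∈subwords u⊑w)) (⊑⇒∈subwords v⊑w))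
  (λ b → All.tabulate λ {u} u∈ → All.tabulate λ {v} v∈ →
     b u v (∈subwords⇒⊑ w u∈) (∈subwords⇒⊑ w v∈))
  (All.all? (λ u → All.all? (λ v →
     (length u ℕ.≟ length v) →-dec
     (∣ ∣ u ∣[ 0F ] - ∣ v ∣[ 0F ] ∣ ℕ.≤? 1))
   (subwords w)) (subwords w))

ℙ? : ∀ L h → Decidable (ℙ L h)
ℙ? L h w = (length w ℕ.≟ L) ×-dec (height w ℕ.≟ h) ×-dec
           balanced? w ×-dec ≡-dec Fin._≟_ (reverse w) w

words : ℕ → List Word
words zero    = [ [] ]
words (suc n) = cartesianProductWith _∷_ (allFin 2) (words n)

ℙ-list : ℕ → ℕ → List Word
ℙ-list L h = filter (ℙ? L h) (words L)

#ℙ : ℕ → ℕ → ℕ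
#ℙ L h = length (ℙ-list L h)

-- ℙ-list L h lists every element of ℙ L h exactly once, so #ℙ L h is indeed
-- the number of elements of ℙ L h.

∈-words : ∀ w → w ∈ words (length w)
∈-words []      = here refl
∈-words (a ∷ w) = ∈-cartesianProductWith⁺ _∷_ (∈-allFin a) (∈-words w)

words-unique : ∀ n → Unique (words n)
words-unique zero    = All.[] AllPairs.∷ AllPairs.[]
words-unique (suc n) =
  Unique.cartesianProductWith⁺ _∷_ ∷-injective (Unique.allFin⁺ 2) (words-unique n)

∈-ℙ-list : ∀ {L h w} → w ∈ ℙ-list L h ⇔ ℙ L h w
∈-ℙ-list {L} {h} {w} = mk⇔
  (λ w∈ → proj₂ (∈-filter⁻ (ℙ? L h) {xs = words L} w∈))
  (λ w∈ℙ → ∈-filter⁺ (ℙ? L h)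
     (subst (λ n → w ∈ words n) (proj₁ w∈ℙ) (∈-words w)) w∈ℙ)

ℙ-list-unique : ∀ L h → Unique (ℙ-list L h)
ℙ-list-unique L h = Unique.filter⁺ (ℙ? L h) (words-unique L)

p : ℤ → ℤ → ℕ
p (+ zero)      (+ zero)  = 1
p (+ zero)      (+ suc _) = 0
p (+ zero)      -[1+ _ ]  = 0
p (+ L@(suc _)) h         = #ℙ L (h %ℕ L)
p -[1+ _ ]      _         = 0

module ℤ-Sum = MonoidSum ℤ.+-0-monoid

ℤ⟦X⟧ : RawRing _ _
ℤ⟦X⟧ = record
  { Carrier = ℕ → ℤ
  ; _≈_     = λ f g → ∀ n → f n ≡ g n
  ; _+_     = λ f g n → f n ℤ.+ g n
  ; _*_     = λ f g n → ℤ-Sum.sum {suc n} λ i → f (toℕ i) ℤ.* g (n ∸ toℕ i)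
  ; -_      = λ f n → ℤ.- f n
  ; 0#      = λ _ → 0ℤ
  ; 1#      = λ { zero → 1ℤ ; (suc _) → 0ℤ }
  }

open RawRing ℤ⟦X⟧ public
  using (_≈_; _+_; _*_; -_; 0#; 1#)
  renaming (Carrier to PowerSeries)

open RawSemiringDefinitions (RawRing.rawSemiring ℤ⟦X⟧) public
  using (_^_)
  renaming (_×_ to _·_)

open MonoidSum
  (CommutativeMonoid.monoid (Pointwise.commutativeMonoid ℕ ℤ.+-0-commutativeMonoid))
  public using (sum-syntax)

X : PowerSeries
X 1 = 1ℤ
X _ = 0ℤ

infixl 6 _-_

_-_ : PowerSeries → PowerSeries → PowerSeries
f - g = f + (- g)

-- Given the coefficients gₙ₋₁, …, g₁, g₀ (in this order) of the reciprocal g of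
-- a series f with constant term 1, prepend gₙ, where g₀ = 1 and
-- gₙ₊₁ = - (f₁ gₙ + f₂ gₙ₋₁ + ⋯ + fₙ₊₁ g₀).

extend : ∀ {n} → PowerSeries → Vec ℤ n → Vec ℤ (suc n)
extend {zero}  f [] = 1ℤ ∷ []
extend {suc n} f gs =
  (ℤ.- ℤ-Sum.sum λ i → f (suc (toℕ i)) ℤ.* Vec.lookup gs i) ∷ gs

reciprocal : PowerSeries → ∀ n → Vec ℤ n
reciprocal f zero    = []
reciprocal f (suc n) = extend f (reciprocal f n)

infix 9 _⁻¹

-- Only meaningful for series with constant term 1; see *-inverseʳ.
_⁻¹ : PowerSeries → PowerSeries
(f ⁻¹) n = Vec.head (reciprocal f (suc n))

infixl 7 _/_

_/_ : PowerSeries → PowerSeries → PowerSeries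
f / g = f * g ⁻¹

private
  lookup-reciprocal : ∀ f n (i : Fin (suc n)) →
                      Vec.lookup (reciprocal f (suc n)) i ≡ (f ⁻¹) (n ∸ toℕ i)
  lookup-reciprocal f zero    0F          = refl
  lookup-reciprocal f (suc n) 0F          = refl
  lookup-reciprocal f (suc n) (Fin.suc i) = lookup-reciprocal f n i

*-inverseʳ : ∀ f → f 0 ≡ 1ℤ → f * f ⁻¹ ≈ 1#
*-inverseʳ f f₀≡1 zero rewrite f₀≡1 = refl
*-inverseʳ f f₀≡1 (suc n)
  rewrite f₀≡1 | ℤ.*-identityˡ ((f ⁻¹) (suc n)) =
  trans
    (cong (λ s → (f ⁻¹) (suc n) ℤ.+ s)
      (sym (ℤ-Sum.sum-cong-≗ λ i → cong (f (suc (toℕ i)) ℤ.*_) (lookup-reciprocal f n i))))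
    (ℤ.+-inverseˡ (ℤ-Sum.sum λ i →
      f (suc (toℕ i)) ℤ.* Vec.lookup (reciprocal f (suc n)) i))

𝒫 : ℕ → PowerSeries
𝒫 h L = + p (+ L) (+ h)

{-# OPTIONS --safe #-}
module Submission where

-- A balanced palindrome with s letters a and t other letters that begins (hence
-- ends) with a is a sequence of s - 1 gaps, the runs of other letters between
-- consecutive a's. It is balanced exactly when equally long stretches of gaps have
-- sums differing by at most one; then every gap is k or k + 1 with
-- k = t div (s - 1), and recording which of the two occurs gives a balanced
-- palindrome of length s - 1 and height t mod (s - 1). So there are p(s - 1, t)
-- such words, and splitting by the first letter yields, for L > h ≥ 1,
-- p(L, h) = p(L - h - 1, h) + p(h - 1, L - h); this is the identity of generating
-- functions, coefficient by coefficient.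

module Words where

  open import Defs hiding (_+_; _*_; -_; _-_; _/_; _^_; _≈_; _⁻¹; 0#; 1#; _·_; X)
  open import Data.Fin using (Fin; toℕ; opposite)
  open import Data.Fin.Patterns using (0F; 1F)
  open import Data.Fin.Properties using (toℕ-injective)
  open import Data.Integer as ℤ using (ℤ)
  open import Data.List
    using (List; []; _∷_; [_]; _∷ʳ_; _++_; length; map; reverse; replicate; take)
  open import Data.List.Membership.Propositional using (_∈_)
  open import Data.List.Membership.Propositional.Properties
    using (∈-map⁺; ∈-map⁻; ∈-++⁺ˡ; ∈-++⁺ʳ; ∈-++⁻)
  open import Data.List.Membership.Propositional.Properties.WithK using (unique∧set⇒bag)
  open import Data.List.Properties
    using (length-map; length-++; length-take; ∷-injectiveˡ; ∷-injectiveʳ; ++-identityʳ;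
           reverse-++; unfold-reverse; reverse-map; map-injective)
  open import Data.List.Relation.Binary.BagAndSetEquality using (∼bag⇒↭)
  open import Data.List.Relation.Binary.Infix.Heterogeneous as Infix using (Infix; here; there)
  import Data.List.Relation.Binary.Infix.Heterogeneous.Properties as Infix
  open import Data.List.Relation.Binary.Permutation.Propositional.Properties using (↭-length)
  import Data.List.Relation.Binary.Pointwise as Pointwise
  open import Data.List.Relation.Binary.Prefix.Heterogeneous as Prefix using (Prefix; []; _∷_)
  import Data.List.Relation.Binary.Prefix.Heterogeneous.Properties as Prefix
  open import Data.List.Relation.Unary.All as All using (All; []; _∷_)
  import Data.List.Relation.Unary.AllPairs as AllPairs
  open import Data.List.Relation.Unary.Any using (here; there)
  open import Data.List.Relation.Unary.Unique.Propositional using (Unique)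
  import Data.List.Relation.Unary.Unique.Propositional.Properties as Unique
  open import Data.Nat
  open import Data.Nat.DivMod
  open import Data.Nat.ListAction using (sum)
  open import Data.Nat.Properties
  open import Data.Nat.Solver using (module +-*-Solver)
  open import Data.Product using (_×_; _,_; ∃-syntax)
  open import Data.Sum using (_⊎_; inj₁; inj₂)
  open import Function using (_∘_; case_of_; mk⇔; Equivalence)
  open import Relation.Binary.PropositionalEquality hiding ([_])
  open import Relation.Nullary using (contradiction)

  -- Letter counts and one-sided balance

  ∣∷∣-same : ∀ a w → ∣ a ∷ w ∣[ a ] ≡ suc ∣ w ∣[ a ]
  ∣∷∣-same 0F w = refl
  ∣∷∣-same 1F w = refl

  ∣∷∣-opposite : ∀ a w → ∣ opposite a ∷ w ∣[ a ] ≡ ∣ w ∣[ a ]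
  ∣∷∣-opposite 0F w = refl
  ∣∷∣-opposite 1F w = refl

  opposite-≢ : ∀ (a : Fin 2) → opposite a ≢ a
  opposite-≢ 0F ()
  opposite-≢ 1F ()

  letter-cases : ∀ (a b : Fin 2) → b ≡ a ⊎ b ≡ opposite a
  letter-cases 0F 0F = inj₁ refl
  letter-cases 0F 1F = inj₂ refl
  letter-cases 1F 0F = inj₂ refl
  letter-cases 1F 1F = inj₁ refl

  ∣∣-complement : ∀ a w → ∣ w ∣[ a ] + ∣ w ∣[ opposite a ] ≡ length w
  ∣∣-complement 0F []       = refl
  ∣∣-complement 1F []       = refl
  ∣∣-complement 0F (0F ∷ w) = cong suc (∣∣-complement 0F w)
  ∣∣-complement 0F (1F ∷ w) = trans (+-suc _ _) (cong suc (∣∣-complement 0F w))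
  ∣∣-complement 1F (0F ∷ w) = trans (+-suc _ _) (cong suc (∣∣-complement 1F w))
  ∣∣-complement 1F (1F ∷ w) = cong suc (∣∣-complement 1F w)

  -- The one-sided inequality suffices, since u and v may be exchanged.
  BalancedIn : Fin 2 → Word → Set
  BalancedIn a w = ∀ {u v} → u ⊑ w → v ⊑ w → length u ≡ length v → ∣ u ∣[ a ] ≤ suc ∣ v ∣[ a ]

  ∣-∣≤1⇒≤ : ∀ {m n} → ∣ m - n ∣ ≤ 1 → m ≤ suc n
  ∣-∣≤1⇒≤ {m} {n} d = begin
    m             ≤⟨ m≤n+∣m-n∣ m n ⟩
    n + ∣ m - n ∣ ≤⟨ +-monoʳ-≤ n d ⟩
    n + 1         ≡⟨ +-comm n 1 ⟩
    suc n         ∎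
    where open ≤-Reasoning

  ≤⇒∣-∣≤1 : ∀ {m n} → m ≤ suc n → n ≤ suc m → ∣ m - n ∣ ≤ 1
  ≤⇒∣-∣≤1 {m} {n} m≤ n≤ with ≤-total m n
  ... | inj₁ m≤n rewrite m≤n⇒∣m-n∣≡n∸m m≤n = m≤n+o⇒m∸n≤o n m (subst (n ≤_) (+-comm 1 m) n≤)
  ... | inj₂ n≤m rewrite m≤n⇒∣n-m∣≡n∸m n≤m = m≤n+o⇒m∸n≤o m n (subst (m ≤_) (+-comm 1 n) m≤)

  -- The two counts of a word add up to its length, so between equally long words an excess of one
  -- letter is a deficit of the other: the bound for `v` against `u` becomes the bound for `u`
  -- against `v`.
  balancedIn-opposite : ∀ a {w} → BalancedIn a w → BalancedIn (opposite a) w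
  balancedIn-opposite a bal {u} {v} u⊑ v⊑ eq = +-cancelˡ-≤ (∣ v ∣[ a ]) _ _ (begin
    ∣ v ∣[ a ] + ∣ u ∣[ opposite a ]       ≤⟨ +-monoˡ-≤ _ (bal v⊑ u⊑ (sym eq)) ⟩
    suc (∣ u ∣[ a ] + ∣ u ∣[ opposite a ]) ≡⟨ cong suc (∣∣-complement a u) ⟩
    suc (length u)                         ≡⟨ cong suc eq ⟩
    suc (length v)                         ≡⟨ cong suc (∣∣-complement a v) ⟨
    suc (∣ v ∣[ a ] + ∣ v ∣[ opposite a ]) ≡⟨ +-suc _ _ ⟨
    ∣ v ∣[ a ] + suc ∣ v ∣[ opposite a ]   ∎)
    where open ≤-Reasoning

  Balanced⇒BalancedIn : ∀ a {w} → Balanced w → BalancedIn a w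
  Balanced⇒BalancedIn 0F bal u⊑ v⊑ eq = ∣-∣≤1⇒≤ (bal _ _ u⊑ v⊑ eq)
  Balanced⇒BalancedIn 1F bal =
    balancedIn-opposite 0F λ u⊑ v⊑ eq → ∣-∣≤1⇒≤ (bal _ _ u⊑ v⊑ eq)

  BalancedIn⇒Balanced : ∀ a {w} → BalancedIn a w → Balanced w
  BalancedIn⇒Balanced 0F bal u v u⊑ v⊑ eq = ≤⇒∣-∣≤1 (bal u⊑ v⊑ eq) (bal v⊑ u⊑ (sym eq))
  BalancedIn⇒Balanced 1F bal = BalancedIn⇒Balanced 0F λ {u} → balancedIn-opposite 1F bal {u}

  -- Words as sequences of gaps

  -- code a [g₁, …, gₘ] = ā^g₁ a ⋯ ā^gₘ a, where ā is the letter other than a.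
  code : Fin 2 → List ℕ → Word
  code a []          = []
  code a (zero ∷ g)  = a ∷ code a g
  code a (suc n ∷ g) = opposite a ∷ code a (n ∷ g)

  code-∷ : ∀ a n g → code a (n ∷ g) ≡ replicate n (opposite a) ++ a ∷ code a g
  code-∷ a zero    g = refl
  code-∷ a (suc n) g = cong (opposite a ∷_) (code-∷ a n g)

  code-++ : ∀ a g h → code a (g ++ h) ≡ code a g ++ code a h
  code-++ a []          h = refl
  code-++ a (zero ∷ g)  h = cong (a ∷_) (code-++ a g h)
  code-++ a (suc n ∷ g) h = cong (opposite a ∷_) (code-++ a (n ∷ g) h)

  code-injective : ∀ a {g h} → code a g ≡ code a h → g ≡ h
  code-injective a {[]}        {[]}        eq = refl
  code-injective a {zero ∷ g}  {zero ∷ h}  eq = cong (0 ∷_) (code-injective a (∷-injectiveʳ eq))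
  code-injective a {zero ∷ g}  {suc n ∷ h} eq = contradiction (sym (∷-injectiveˡ eq)) (opposite-≢ a)
  code-injective a {suc m ∷ g} {zero ∷ h}  eq = contradiction (∷-injectiveˡ eq) (opposite-≢ a)
  code-injective a {suc m ∷ g} {suc n ∷ h} eq
    with refl ← code-injective a {m ∷ g} {n ∷ h} (∷-injectiveʳ eq) = refl
  code-injective a {[]}        {zero ∷ h}  ()
  code-injective a {[]}        {suc n ∷ h} ()
  code-injective a {zero ∷ g}  {[]}        ()
  code-injective a {suc m ∷ g} {[]}        ()

  length-code : ∀ a g → length (code a g) ≡ length g + sum g
  length-code a []          = refl
  length-code a (zero ∷ g)  = cong suc (length-code a g)
  length-code a (suc n ∷ g) = trans (cong suc (length-code a (n ∷ g))) (sym (+-suc (suc (length g)) (n + sum g)))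

  ∣code∣ : ∀ a g → ∣ code a g ∣[ a ] ≡ length g
  ∣code∣ a []          = refl
  ∣code∣ a (zero ∷ g)  = trans (∣∷∣-same a _) (cong suc (∣code∣ a g))
  ∣code∣ a (suc n ∷ g) = trans (∣∷∣-opposite a _) (∣code∣ a (n ∷ g))

  ∣code∣-opposite : ∀ a g → ∣ code a g ∣[ opposite a ] ≡ sum g
  ∣code∣-opposite a g = +-cancelˡ-≡ (length g) _ _ (begin
    length g + ∣ code a g ∣[ opposite a ]         ≡⟨ cong (_+ ∣ code a g ∣[ opposite a ]) (∣code∣ a g) ⟨
    ∣ code a g ∣[ a ] + ∣ code a g ∣[ opposite a ] ≡⟨ ∣∣-complement a (code a g) ⟩
    length (code a g)                             ≡⟨ length-code a g ⟩
    length g + sum g                              ∎)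
    where open ≡-Reasoning

  -- In `code` every run is closed by an `a`; a last run that no `a` closes is left over as the
  -- `replicate`.
  code-parse : ∀ a w → ∃[ g ] ∃[ n ] w ≡ code a g ++ replicate n (opposite a)
  code-parse a [] = [] , 0 , refl
  code-parse a (b ∷ w) with letter-cases a b | code-parse a w
  ... | inj₁ refl | g     , n , refl = 0 ∷ g , n , refl
  ... | inj₂ refl | []    , n , refl = [] , suc n , refl
  ... | inj₂ refl | m ∷ g , n , refl = suc m ∷ g , n , refl

  -- Reversal and palindromes

  replicate-∷ʳ : ∀ {A : Set} n (x : A) → replicate n x ∷ʳ x ≡ x ∷ replicate n x
  replicate-∷ʳ zero    x = refl
  replicate-∷ʳ (suc n) x = cong (x ∷_) (replicate-∷ʳ n x)

  reverse-replicate : ∀ {A : Set} n (x : A) → reverse (replicate n x) ≡ replicate n x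
  reverse-replicate zero    x = refl
  reverse-replicate (suc n) x = begin
    reverse (x ∷ replicate n x)  ≡⟨ unfold-reverse x (replicate n x) ⟩
    reverse (replicate n x) ∷ʳ x ≡⟨ cong (_∷ʳ x) (reverse-replicate n x) ⟩
    replicate n x ∷ʳ x           ≡⟨ replicate-∷ʳ n x ⟩
    x ∷ replicate n x            ∎
    where open ≡-Reasoning

  -- With the leading `a`, each gap stands between two letters `a`, so reversing the word only
  -- reverses the order of the gaps.
  reverse-code : ∀ a g → reverse (a ∷ code a g) ≡ a ∷ code a (reverse g)
  reverse-code a []      = refl
  reverse-code a (n ∷ g) = begin
    reverse (a ∷ code a (n ∷ g))                 ≡⟨ cong (reverse ∘ (a ∷_)) (code-∷ a n g) ⟩
    reverse ((a ∷ ns) ++ a ∷ code a g)           ≡⟨ reverse-++ (a ∷ ns) (a ∷ code a g) ⟩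
    reverse (a ∷ code a g) ++ reverse (a ∷ ns)   ≡⟨ cong₂ _++_ (reverse-code a g) (unfold-reverse a ns) ⟩
    a ∷ code a (reverse g) ++ (reverse ns ∷ʳ a)
      ≡⟨ cong (λ r → a ∷ code a (reverse g) ++ (r ∷ʳ a)) (reverse-replicate n _) ⟩
    a ∷ code a (reverse g) ++ (ns ∷ʳ a)          ≡⟨ cong (λ r → a ∷ code a (reverse g) ++ r) (code-∷ a n []) ⟨
    a ∷ code a (reverse g) ++ code a [ n ]       ≡⟨ cong (a ∷_) (code-++ a (reverse g) [ n ]) ⟨
    a ∷ code a (reverse g ∷ʳ n)                  ≡⟨ cong ((a ∷_) ∘ code a) (unfold-reverse n g) ⟨
    a ∷ code a (reverse (n ∷ g))                 ∎
    where
    open ≡-Reasoning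
    ns = replicate n (opposite a)

  palindrome-code : ∀ a w → Palindrome (a ∷ w) → ∃[ g ] w ≡ code a g
  palindrome-code a w pal with code-parse a w
  ... | g , zero  , refl = g , ++-identityʳ (code a g)
  -- An unclosed last run would make the word end in the other letter, although it begins with `a`.
  ... | g , suc n , refl = contradiction (∷-injectiveˡ (trans (sym eq) pal)) (opposite-≢ a)
    where
    open ≡-Reasoning
    ns = replicate (suc n) (opposite a)
    eq : reverse (a ∷ code a g ++ ns) ≡ ns ++ reverse (a ∷ code a g)
    eq = begin
      reverse ((a ∷ code a g) ++ ns)        ≡⟨ reverse-++ (a ∷ code a g) ns ⟩
      reverse ns ++ reverse (a ∷ code a g)  ≡⟨ cong (_++ reverse (a ∷ code a g)) (reverse-replicate (suc n) _) ⟩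
      ns ++ reverse (a ∷ code a g)          ∎

  -- Balance of a word and balance of its gaps

  infix 4 _⊑ℕ_

  _⊑ℕ_ : List ℕ → List ℕ → Set
  g ⊑ℕ h = Infix _≡_ g h

  -- One-sided like `BalancedIn`: exchanging `b` and `c` gives the other inequality.
  GapBalanced : List ℕ → Set
  GapBalanced g = ∀ {b c} → b ⊑ℕ g → c ⊑ℕ g → length b ≡ length c → sum b ≤ suc (sum c)

  prefix-refl : ∀ {A : Set} (xs : List A) → Prefix _≡_ xs xs
  prefix-refl xs = Prefix.fromPointwise (Pointwise.refl refl)

  prefix-++ : ∀ {A : Set} {xs ys : List A} → Prefix _≡_ xs ys → ∃[ zs ] ys ≡ xs ++ zs
  prefix-++ []         = _ , refl
  prefix-++ (refl ∷ p) with zs , refl ← prefix-++ p = zs , refl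

  prefix-take : ∀ {A : Set} n (xs : List A) → Prefix _≡_ (take n xs) xs
  prefix-take zero    xs       = []
  prefix-take (suc n) []       = []
  prefix-take (suc n) (x ∷ xs) = refl ∷ prefix-take n xs

  prefix-code : ∀ a {b g} → Prefix _≡_ b g → Prefix _≡_ (code a b) (code a g)
  prefix-code a {b} p with zs , refl ← prefix-++ p =
    subst (Prefix _≡_ (code a b)) (sym (code-++ a b zs)) (prefix-refl (code a b) Prefix.++ᵖ code a zs)

  ⊑-code-∷ : ∀ a n {x g} → x ⊑ a ∷ code a g → x ⊑ code a (n ∷ g)
  ⊑-code-∷ a zero    x⊑ = x⊑
  ⊑-code-∷ a (suc n) x⊑ = there (⊑-code-∷ a n x⊑)

  ⊑-code : ∀ a {b g} → b ⊑ℕ g → code a b ⊑ code a g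
  ⊑-code a (here p)   = here (prefix-code a p)
  ⊑-code a (there {n} b⊑) = ⊑-code-∷ a n (there (⊑-code a b⊑))

  ⊑-∷code : ∀ a {b g} → b ⊑ℕ g → a ∷ code a b ⊑ a ∷ code a g
  ⊑-∷code a (here p)       = here (refl ∷ prefix-code a p)
  ⊑-∷code a (there {n} b⊑) = there (⊑-code-∷ a n (⊑-∷code a b⊑))

  -- A nonempty code ends in `a`, so a proper prefix misses at least that letter.
  ∣take-code∣ : ∀ a ℓ g → ℓ < length (code a g) → ∣ take ℓ (code a g) ∣[ a ] < length g
  ∣take-code∣ a zero    (_ ∷ g)     _       = s≤s z≤n
  ∣take-code∣ a (suc ℓ) (zero ∷ g)  (s≤s p) rewrite ∣∷∣-same a (take ℓ (code a g)) =
    s≤s (∣take-code∣ a ℓ g p)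
  ∣take-code∣ a (suc ℓ) (suc n ∷ g) (s≤s p) rewrite ∣∷∣-opposite a (take ℓ (code a (n ∷ g))) =
    ∣take-code∣ a ℓ (n ∷ g) p

  -- If the sums of b and c differed by two or more, then a ∷ code a c would be no
  -- longer than code a b without its last letter, but contain two more letters a.
  BalancedIn⇒GapBalanced : ∀ a {g} → BalancedIn a (a ∷ code a g) → GapBalanced g
  BalancedIn⇒GapBalanced a {g} bal {b} {c} b⊑ c⊑ eq = ≮⇒≥ λ sum< →
    let
      ℓ = length (a ∷ code a c)
      ℓ<  : ℓ < length (code a b)
      ℓ<  = begin-strict
        suc (length (code a c))    ≡⟨ cong suc (length-code a c) ⟩
        suc (length c + sum c)     ≡⟨ cong (λ n → suc (n + sum c)) eq ⟨
        suc (length b + sum c)     ≡⟨ +-suc _ _ ⟨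
        length b + suc (sum c)     <⟨ +-monoʳ-< (length b) sum< ⟩
        length b + sum b           ≡⟨ length-code a b ⟨
        length (code a b)          ∎
      x   = take ℓ (code a b)
      x⊑  = there (Infix.Prefix-Infix-trans trans (prefix-take ℓ (code a b)) (⊑-code a b⊑))
      ∣x∣ = trans (length-take ℓ (code a b)) (m≤n⇒m⊓n≡m (<⇒≤ ℓ<))
    in <⇒≱ (begin-strict
      ∣ x ∣[ a ]       <⟨ ∣take-code∣ a ℓ b ℓ< ⟩
      length b         ≡⟨ eq ⟩
      length c         ∎)
    (s≤s⁻¹ (begin
      suc (length c)               ≡⟨ cong suc (∣code∣ a c) ⟨
      suc ∣ code a c ∣[ a ]        ≡⟨ ∣∷∣-same a (code a c) ⟨
      ∣ a ∷ code a c ∣[ a ]        ≤⟨ bal (⊑-∷code a c⊑) x⊑ (sym ∣x∣) ⟩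
      suc ∣ x ∣[ a ]               ∎))
    where open ≤-Reasoning

  -- A prefix with `c` letters `a` contains the code of the first `c` gaps, whose length is
  -- `c + sum b`.
  many⇒long-prefix : ∀ a c {y} g → Prefix _≡_ y (code a g) → c ≤ ∣ y ∣[ a ] →
                ∃[ b ] Prefix _≡_ b g × length b ≡ c × c + sum b ≤ length y
  many⇒long-prefix a zero    g           p          c≤ = [] , [] , refl , z≤n
  many⇒long-prefix a (suc c) (zero ∷ g)  (_∷_ {as = y} refl p) c≤ =
    let b , b⊑ , ∣b∣ , b≤ = many⇒long-prefix a c g p (s≤s⁻¹ (subst (suc c ≤_) (∣∷∣-same a y) c≤))
    in 0 ∷ b , refl ∷ b⊑ , cong suc ∣b∣ , s≤s b≤
  many⇒long-prefix a (suc c) (suc n ∷ g) (_∷_ {as = y} refl p) c≤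
    with many⇒long-prefix a (suc c) (n ∷ g) p (subst (suc c ≤_) (∣∷∣-opposite a y) c≤)
  -- Having length `suc c`, the recursive result starts with the shortened gap `n`, which is
  -- restored to `suc n`.
  ... | _ ∷ b , refl ∷ b⊑ , ∣b∣ , b≤ =
    suc n ∷ b , refl ∷ b⊑ , ∣b∣ , s≤s (subst (_≤ length y) (sym (+-suc _ _)) b≤)

  -- The first `suc c` letters `a` of `y` enclose `c` complete gaps. The separate first gap `n`
  -- stands for the one in which `y` may begin; being possibly cut, it is not counted.
  many⇒long : ∀ a c n {y} g → y ⊑ code a (n ∷ g) → suc c ≤ ∣ y ∣[ a ] →
         ∃[ b ] b ⊑ℕ g × length b ≡ c × suc c + sum b ≤ length y
  many⇒long a c zero    g       (here (_∷_ {as = y} refl p)) c< =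
    let b , b⊑ , ∣b∣ , b≤ = many⇒long-prefix a c g p (s≤s⁻¹ (subst (suc c ≤_) (∣∷∣-same a y) c<))
    in b , here b⊑ , ∣b∣ , s≤s b≤
  many⇒long a c zero    []      (there (here []))   ()
  many⇒long a c zero    (n ∷ g) (there y⊑)          c< =
    let b , b⊑ , ∣b∣ , b≤ = many⇒long a c n g y⊑ c< in b , there b⊑ , ∣b∣ , b≤
  many⇒long a c (suc n) g       (here (_∷_ {as = y} refl p)) c< =
    let b , b⊑ , ∣b∣ , b≤ = many⇒long a c n g (here p) (subst (suc c ≤_) (∣∷∣-opposite a y) c<)
    in b , b⊑ , ∣b∣ , m≤n⇒m≤1+n b≤
  many⇒long a c (suc n) g       (there y⊑)          c< = many⇒long a c n g y⊑ c<

  -- With at most `c` letters `a`, the prefix stops before the `a` that closes gap number `suc c`,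
  -- hence is shorter than the code of the first `suc c` gaps.
  few⇒short-prefix : ∀ a c {x} g → Prefix _≡_ x (code a g) → ∣ x ∣[ a ] ≤ c → c < length g →
               ∃[ b ] Prefix _≡_ b g × length b ≡ suc c × length x < suc c + sum b
  few⇒short-prefix a c       (zero ∷ g)  (_∷_ {as = x} refl p) c≥ c<
    with subst (_≤ c) (∣∷∣-same a x) c≥
  few⇒short-prefix a (suc c) (zero ∷ g)  (_∷_ {as = x} refl p) _  (s≤s c<) | s≤s c≥ =
    let b , b⊑ , ∣b∣ , <b = few⇒short-prefix a c g p c≥ c<
    in 0 ∷ b , refl ∷ b⊑ , cong suc ∣b∣ , s≤s <b
  few⇒short-prefix a c       (suc n ∷ g) (_∷_ {as = x} refl p) c≥ c<
    with few⇒short-prefix a c (n ∷ g) p (subst (_≤ c) (∣∷∣-opposite a x) c≥) c<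
  ... | _ ∷ b , refl ∷ b⊑ , ∣b∣ , <b =
    suc n ∷ b , refl ∷ b⊑ , ∣b∣ , s≤s (subst (length x <_) (sym (+-suc _ _)) <b)
  few⇒short-prefix a c       (n ∷ g)     []                    _  (s≤s c<) =
    take (suc c) (n ∷ g) , prefix-take (suc c) (n ∷ g) ,
    cong suc (trans (length-take c g) (m≤n⇒m⊓n≡m c<)) , s≤s z≤n

  -- A factor with at most `c` letters `a` meets at most `suc c` gaps, so it is shorter than the
  -- code of some stretch of that many.
  few⇒short : ∀ a c {x} g → x ⊑ code a g → ∣ x ∣[ a ] ≤ c → c < length g →
        ∃[ b ] b ⊑ℕ g × length b ≡ suc c × length x < suc c + sum b
  few⇒short a c {x} (zero ∷ g) (there x⊑) c≥ (s≤s c≤) with m≤n⇒m<n∨m≡n c≤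
  ... | inj₁ c< = let b , b⊑ , rest = few⇒short a c g x⊑ c≥ c< in b , there b⊑ , rest
  -- Only `c` gaps follow this one, so the stretch consists of it and all of them, and `x` is
  -- bounded by the whole remaining code.
  ... | inj₂ refl = 0 ∷ g , here (prefix-refl _) , refl , s≤s
    (subst (length x ≤_) (length-code a g) (Infix.length-mono x⊑))
  few⇒short a c {x} (suc n ∷ g) (there x⊑) c≥ c< with few⇒short a c (n ∷ g) x⊑ c≥ c<
  ... | b , there b⊑ , rest = b , there b⊑ , rest
  ... | _ ∷ b , here (refl ∷ p) , ∣b∣ , <b =
    suc n ∷ b , here (refl ∷ p) , ∣b∣ , <-trans <b (+-monoʳ-< (suc c) (n<1+n _))
  few⇒short a c g           (here p)   c≥ c< =
    let b , b⊑ , rest = few⇒short-prefix a c g p c≥ c< in b , here b⊑ , rest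

  extend-prefix : ∀ {b g} → Prefix _≡_ b g → length b < length g →
                  ∃[ d ] Prefix _≡_ d g × length d ≡ suc (length b) × sum b ≤ sum d
  extend-prefix {g = n ∷ g} []         _       = n ∷ [] , refl ∷ [] , refl , z≤n
  extend-prefix             (refl ∷ p) (s≤s <) =
    let d , d⊑ , ∣d∣ , ≤d = extend-prefix p < in _ ∷ d , refl ∷ d⊑ , cong suc ∣d∣ , +-monoʳ-≤ _ ≤d

  -- The case not covered by `few⇒short` is a factor that starts with the leading `a`, before the
  -- first gap.
  few⇒short-∷ : ∀ a c {x} g → x ⊑ a ∷ code a g → ∣ x ∣[ a ] ≤ c → c < length g →
          ∃[ b ] b ⊑ℕ g × length b ≡ suc c × length x < suc c + sum b
  few⇒short-∷ a c g (there x⊑) c≥ c< = few⇒short a c g x⊑ c≥ c<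
  few⇒short-∷ a c g (here [])  c≥ c< = few⇒short a c g (here []) z≤n c<
  few⇒short-∷ a c g (here (_∷_ {as = x} refl p)) c≥ c< with subst (_≤ c) (∣∷∣-same a x) c≥
  few⇒short-∷ a (suc c) g (here (_∷_ {as = x} refl p)) _ c< | s≤s c≥ =
    let b , b⊑ , ∣b∣ , <b = few⇒short-prefix a c g p c≥ (<-trans (n<1+n c) c<)
        -- The leading `a` is one of the counted letters, so `b` has one gap too few; `c<` leaves
        -- room for one more, which does not lower the sum.
        d , d⊑ , ∣d∣ , b≤d = extend-prefix b⊑ (subst (_< length g) (sym ∣b∣) c<)
    in d , here d⊑ , trans ∣d∣ (cong suc ∣b∣) , s≤s (<-≤-trans <b (+-monoʳ-≤ (suc c) b≤d))

  -- Suppose `x` has `c` letters `a` and `y`, of the same length, at least `c + 2`. Then `y`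
  -- contains `c + 1` complete gaps `d`, while `x` is shorter than the code of some `c + 1` gaps
  -- `b`. Comparing lengths gives `sum b > sum d + 1`.
  GapBalanced⇒BalancedIn : ∀ a {g} → GapBalanced g → BalancedIn a (a ∷ code a g)
  GapBalanced⇒BalancedIn a {g} bal {y} {x} y⊑ x⊑ eq = ≮⇒≥ λ c< →
    let
      c = ∣ x ∣[ a ]
      -- The artificial first gap `0` accounts for the leading `a`: `code a (0 ∷ g)` unfolds to
      -- `a ∷ code a g`.
      d , d⊑ , ∣d∣ , d≤ = many⇒long a (suc c) 0 g y⊑ c<
      c<∣g∣ = subst (_≤ length g) ∣d∣ (Infix.length-mono d⊑)
      b , b⊑ , ∣b∣ , <b = few⇒short-∷ a c g x⊑ ≤-refl c<∣g∣
    in <⇒≱ (+-cancelˡ-< (suc c) _ _ (begin-strict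
         suc c + suc (sum d) ≡⟨ +-suc (suc c) (sum d) ⟩
         suc (suc c) + sum d ≤⟨ d≤ ⟩
         length y            ≡⟨ eq ⟩
         length x            <⟨ <b ⟩
         suc c + sum b       ∎))
       (bal b⊑ d⊑ (trans ∣b∣ (sym ∣d∣)))
    where open ≤-Reasoning

  -- Gaps with two consecutive values

  gaps : ℕ → Word → List ℕ
  gaps k = map λ b → k + toℕ b

  toℕ-+-injective : ∀ k {b c : Fin 2} → k + toℕ b ≡ k + toℕ c → b ≡ c
  toℕ-+-injective k = toℕ-injective ∘ +-cancelˡ-≡ k _ _

  height-∷ : ∀ b u → height (b ∷ u) ≡ toℕ b + height u
  height-∷ 0F u = refl
  height-∷ 1F u = refl

  sum-gaps : ∀ k u → sum (gaps k u) ≡ length u * k + height u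
  sum-gaps k []      = refl
  sum-gaps k (b ∷ u) = begin
    (k + toℕ b) + sum (gaps k u)             ≡⟨ cong (k + toℕ b +_) (sum-gaps k u) ⟩
    (k + toℕ b) + (length u * k + height u)
      ≡⟨ solve 4 (λ k b x y → (k :+ b) :+ (x :+ y) := (k :+ x) :+ (b :+ y)) refl
           k (toℕ b) (length u * k) (height u) ⟩
    (k + length u * k) + (toℕ b + height u)  ≡⟨ cong (k + length u * k +_) (height-∷ b u) ⟨
    (k + length u * k) + height (b ∷ u)      ∎
    where
    open ≡-Reasoning
    open +-*-Solver

  map-prefix⁻ : ∀ {A B : Set} (f : A → B) {ys} xs → Prefix _≡_ ys (map f xs) →
                ∃[ zs ] ys ≡ map f zs × Prefix _≡_ zs xs
  map-prefix⁻ f (x ∷ xs) (refl ∷ p) with zs , refl , q ← map-prefix⁻ f xs p = x ∷ zs , refl , refl ∷ q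
  map-prefix⁻ f xs       []         = [] , refl , []

  map-infix⁻ : ∀ {A B : Set} (f : A → B) {ys} xs → Infix _≡_ ys (map f xs) →
               ∃[ zs ] ys ≡ map f zs × Infix _≡_ zs xs
  map-infix⁻ f (x ∷ xs) (there i) = let zs , eq , j = map-infix⁻ f xs i in zs , eq , there j
  map-infix⁻ f xs       (here p)  = let zs , eq , q = map-prefix⁻ f xs p in zs , eq , here q

  -- For words of equal length the summands `length * k` in `sum-gaps` agree, so sums of gaps differ
  -- exactly as heights do. The converse below uses the same cancellation.
  Balanced⇒GapBalanced : ∀ k {u} → BalancedIn 1F u → GapBalanced (gaps k u)
  Balanced⇒GapBalanced k {u} bal b⊑ c⊑ eq
    with x , refl , x⊑ ← map-infix⁻ _ u b⊑
       | y , refl , y⊑ ← map-infix⁻ _ u c⊑ = begin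
    sum (gaps k x)                 ≡⟨ sum-gaps k x ⟩
    length x * k + height x        ≤⟨ +-mono-≤ (≤-reflexive (cong (_* k) ∣x∣≡∣y∣)) (bal x⊑ y⊑ ∣x∣≡∣y∣) ⟩
    length y * k + suc (height y)  ≡⟨ +-suc (length y * k) (height y) ⟩
    suc (length y * k + height y)  ≡⟨ cong suc (sum-gaps k y) ⟨
    suc (sum (gaps k y))           ∎
    where
    open ≤-Reasoning
    ∣x∣≡∣y∣ = trans (sym (length-map _ x)) (trans eq (length-map _ y))

  GapBalanced⇒Balanced : ∀ k {u} → GapBalanced (gaps k u) → BalancedIn 1F u
  GapBalanced⇒Balanced k bal {x} {y} x⊑ y⊑ eq = +-cancelˡ-≤ (length x * k) _ _ (begin
    length x * k + height x        ≡⟨ sum-gaps k x ⟨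
    sum (gaps k x)                 ≤⟨ bal (map⁺ x⊑) (map⁺ y⊑) (trans (length-map _ x) (trans eq (sym (length-map _ y)))) ⟩
    suc (sum (gaps k y))           ≡⟨ cong suc (sum-gaps k y) ⟩
    suc (length y * k + height y)  ≡⟨ +-suc (length y * k) (height y) ⟨
    length y * k + suc (height y)  ≡⟨ cong (λ n → n * k + suc (height y)) eq ⟨
    length x * k + suc (height y)  ∎)
    where
    open ≤-Reasoning
    map⁺ : ∀ {z w} → z ⊑ w → gaps k z ⊑ℕ gaps k w
    map⁺ = Infix.map⁺ _ _ ∘ Infix.map (cong λ b → k + toℕ b)

  -- The size of the gaps in a balanced sequence

  ∈⇒⊑ : ∀ {n g} → n ∈ g → [ n ] ⊑ℕ g
  ∈⇒⊑ (here refl) = here (refl ∷ [])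
  ∈⇒⊑ (there n∈)  = there (∈⇒⊑ n∈)

  gap-≤ : ∀ {g m n} → GapBalanced g → m ∈ g → n ∈ g → m ≤ suc n
  gap-≤ {m = m} {n} bal m∈ n∈ =
    subst₂ (λ x y → x ≤ suc y) (+-identityʳ m) (+-identityʳ n) (bal (∈⇒⊑ m∈) (∈⇒⊑ n∈) refl)

  sum-≤ : ∀ {k g} → All (_≤ k) g → sum g ≤ length g * k
  sum-≤ []        = z≤n
  sum-≤ (n≤ ∷ g≤) = +-mono-≤ n≤ (sum-≤ g≤)

  sum-≥ : ∀ {k g} → All (k ≤_) g → length g * k ≤ sum g
  sum-≥ []        = z≤n
  sum-≥ (≤n ∷ ≤g) = +-mono-≤ ≤n (sum-≥ ≤g)

  sum-< : ∀ {k g n} → All (_≤ k) g → n ∈ g → n < k → sum g < length g * k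
  sum-< (_ ∷ g≤)  (here refl) n< = +-mono-<-≤ n< (sum-≤ g≤)
  sum-< (m≤ ∷ g≤) (there n∈)  n< = +-mono-≤-< m≤ (sum-< g≤ n∈ n<)

  -- By `gap-≤` all gaps are at most `n + 1` and `n` itself is smaller, so the mean is below
  -- `n + 1`. Likewise all gaps are at least `n - 1`, hence so is the integer part of the mean.
  average : ∀ {g n} .{{_ : NonZero (length g)}} → GapBalanced g → n ∈ g →
            sum g / length g ≤ n × n ≤ suc (sum g / length g)
  average {g} {n} bal n∈ = s≤s⁻¹ lower , upper n n∈
    where
    open ≤-Reasoning
    lower : sum g / length g < suc n
    lower = m<n*o⇒m/o<n (subst (sum g <_) (*-comm (length g) (suc n))
              (sum-< (All.tabulate λ m∈ → gap-≤ bal m∈ n∈) n∈ (n<1+n n)))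
    upper : ∀ n → n ∈ g → n ≤ suc (sum g / length g)
    upper zero    _  = z≤n
    upper (suc n) n∈ = s≤s (begin
      n                           ≡⟨ m*n/n≡m n (length g) ⟨
      n * length g / length g     ≡⟨ cong (_/ length g) (*-comm n (length g)) ⟩
      length g * n / length g     ≤⟨ /-monoˡ-≤ (length g) (sum-≥ (All.tabulate λ m∈ → s≤s⁻¹ (gap-≤ bal n∈ m∈))) ⟩
      sum g / length g            ∎)

  digit : ∀ {k n} → k ≤ n → n ≤ suc k → ∃[ b ] n ≡ k + toℕ {2} b
  digit {k} k≤ ≤k with m≤n⇒m<n∨m≡n ≤k
  ... | inj₁ (s≤s n≤k) = 0F , trans (≤-antisym n≤k k≤) (sym (+-identityʳ k))
  ... | inj₂ refl      = 1F , +-comm 1 k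

  digits : ∀ {k g} → All (λ n → ∃[ b ] n ≡ k + toℕ {2} b) g → ∃[ u ] g ≡ gaps k u
  digits []                   = [] , refl
  digits ((b , refl) ∷ ps) with u , refl ← digits ps = b ∷ u , refl

  GapBalanced⇒gaps : ∀ {g} .{{_ : NonZero (length g)}} → GapBalanced g →
                     ∃[ u ] g ≡ gaps (sum g / length g) u
  GapBalanced⇒gaps bal = digits (All.tabulate λ n∈ → let ≤n , n≤ = average bal n∈ in digit ≤n n≤)

  -- Balanced palindromes with a given first letter

  encode : Fin 2 → ℕ → Word → Word
  encode a k u = a ∷ code a (gaps k u)

  encode-injective : ∀ a k {u v} → encode a k u ≡ encode a k v → u ≡ v
  encode-injective a k = map-injective (toℕ-+-injective k) ∘ code-injective a ∘ ∷-injectiveʳ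

  record Starting (a : Fin 2) (s t : ℕ) (w : Word) : Set where
    constructor starting
    field
      {tail}     : Word
      begins     : w ≡ a ∷ tail
      same       : ∣ w ∣[ a ] ≡ s
      other      : ∣ w ∣[ opposite a ] ≡ t
      balanced   : Balanced w
      palindrome : Palindrome w

  ∣∷code∣ : ∀ a g → ∣ a ∷ code a g ∣[ a ] ≡ suc (length g)
  ∣∷code∣ a g = trans (∣∷∣-same a (code a g)) (cong suc (∣code∣ a g))

  ∣∷code∣-opposite : ∀ a g → ∣ a ∷ code a g ∣[ opposite a ] ≡ sum g
  ∣∷code∣-opposite 0F = ∣code∣-opposite 0F
  ∣∷code∣-opposite 1F = ∣code∣-opposite 1F

  encode-starting : ∀ a k {u} → Balanced u → Palindrome u →
                    Starting a (suc (length u)) (length u * k + height u) (encode a k u)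
  encode-starting a k {u} bal pal = starting refl
    (trans (∣∷code∣ a (gaps k u)) (cong suc (length-map _ u)))
    (trans (∣∷code∣-opposite a (gaps k u)) (sum-gaps k u))
    (BalancedIn⇒Balanced a λ {x} → GapBalanced⇒BalancedIn a
      (Balanced⇒GapBalanced k (Balanced⇒BalancedIn 1F bal)) {x})
    (trans (reverse-code a (gaps k u))
      (cong ((a ∷_) ∘ code a) (trans (sym (reverse-map _ u)) (cong (gaps k) pal))))

  -- A palindrome that begins with `a` also ends with it and so decodes into gaps; `code-injective`
  -- then turns the symmetry of the word into symmetry of the gaps.
  starting⁻ : ∀ {a s t w} → Starting a s t w →
              ∃[ g ] w ≡ a ∷ code a g × s ≡ suc (length g) × t ≡ sum g × GapBalanced g × reverse g ≡ g
  starting⁻ {a} (starting {tail} refl refl refl bal pal) with g , refl ← palindrome-code a tail pal =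
    g , refl , ∣∷code∣ a g , ∣∷code∣-opposite a g ,
    BalancedIn⇒GapBalanced a (Balanced⇒BalancedIn a bal) ,
    code-injective a (∷-injectiveʳ (trans (sym (reverse-code a g)) pal))

  -- With a single `a` there are no gaps, so the other letter cannot occur. With `suc m` letters `a`
  -- there are `m` gaps of total `t`: the quotient `t / m` is the smaller gap value, and the
  -- remainder counts the larger gaps.
  encodings : Fin 2 → ℕ → ℕ → List Word
  encodings a zero            t       = []
  encodings a (suc zero)      zero    = [ [ a ] ]
  encodings a (suc zero)      (suc t) = []
  encodings a (suc m@(suc _)) t       = map (encode a (t / m)) (ℙ-list m (t % m))

  -- For `m = 0` the counts agree with the conventions p(0,0) = 1 and p(0,t) = 0 for t > 0.
  length-encodings : ∀ a m t → length (encodings a (suc m) t) ≡ p (ℤ.+ m) (ℤ.+ t)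
  length-encodings a zero      zero    = refl
  length-encodings a zero      (suc t) = refl
  length-encodings a m@(suc _) t       = length-map _ (ℙ-list m (t % m))

  encodings-unique : ∀ a s t → Unique (encodings a s t)
  encodings-unique a zero            t       = AllPairs.[]
  encodings-unique a (suc zero)      zero    = [] AllPairs.∷ AllPairs.[]
  encodings-unique a (suc zero)      (suc t) = AllPairs.[]
  encodings-unique a (suc m@(suc _)) t       = Unique.map⁺ (encode-injective a (t / m)) (ℙ-list-unique m (t % m))

  divMod : ∀ m n .{{_ : NonZero n}} → n * (m / n) + m % n ≡ m
  divMod m n = begin
    n * (m / n) + m % n ≡⟨ +-comm (n * (m / n)) (m % n) ⟩
    m % n + n * (m / n) ≡⟨ cong (m % n +_) (*-comm n (m / n)) ⟩
    m % n + m / n * n   ≡⟨ m≡m%n+[m/n]*n m n ⟨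
    m                   ∎
    where open ≡-Reasoning

  ∈-encodings⁻ : ∀ a s t {w} → w ∈ encodings a s t → Starting a s t w
  ∈-encodings⁻ a (suc zero)      zero (here refl) = encode-starting a 0 (BalancedIn⇒Balanced 0F balanced-[]) refl
    where
    balanced-[] : BalancedIn 0F []
    balanced-[] (here []) (here []) _ = z≤n
  ∈-encodings⁻ a (suc m@(suc _)) t    w∈
    with u , u∈ , refl ← ∈-map⁻ (encode a (t / m)) w∈
    with ∣u∣≡m , height≡ , bal , pal ← Equivalence.to (∈-ℙ-list {m} {t % m}) u∈ =
    subst₂ (λ s t′ → Starting a s t′ (encode a (t / m) u))
      (cong suc ∣u∣≡m)
      (trans (cong₂ (λ x y → x * (t / m) + y) ∣u∣≡m height≡) (divMod t m))
      (encode-starting a (t / m) bal pal)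

  ∈-encodings⁺ : ∀ {a s t w} → Starting a s t w → w ∈ encodings a s t
  ∈-encodings⁺ {a} st with starting⁻ st
  ... | [] , refl , refl , refl , _ , _ = here refl
  ... | g@(_ ∷ _) , refl , refl , refl , bal , pal
    with u , g≡ ← GapBalanced⇒gaps bal =
    subst (λ h → a ∷ code a h ∈ encodings a (suc m) (sum g)) (sym g≡)
      (∈-map⁺ (encode a k) (Equivalence.from ∈-ℙ-list (∣u∣≡m , height≡ , balanced , palindrome)))
    where
    open ≡-Reasoning
    m = length g
    k = sum g / m
    ∣u∣≡m : length u ≡ m
    ∣u∣≡m = trans (sym (length-map _ u)) (cong length (sym g≡))
    height≡ : height u ≡ sum g % m
    height≡ = +-cancelˡ-≡ (m * k) _ _ (begin
      m * k + height u         ≡⟨ cong (λ n → n * k + height u) ∣u∣≡m ⟨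
      length u * k + height u  ≡⟨ sum-gaps k u ⟨
      sum (gaps k u)           ≡⟨ cong sum g≡ ⟨
      sum g                    ≡⟨ divMod (sum g) m ⟨
      m * k + sum g % m        ∎)
    balanced = BalancedIn⇒Balanced 1F (GapBalanced⇒Balanced k (subst GapBalanced g≡ bal))
    palindrome = map-injective (toℕ-+-injective k)
      (trans (reverse-map _ u) (subst (λ h → reverse h ≡ h) g≡ pal))

  -- Splitting by the first letter

  ∣∣+height : ∀ w → ∣ w ∣[ 0F ] + height w ≡ length w
  ∣∣+height = ∣∣-complement 0F

  split : ℕ → ℕ → List Word
  split z o = encodings 0F z o ++ encodings 1F o z

  ∈-split⁺ : ∀ {z o w} → 0 < z + o → ℙ (z + o) o w → w ∈ split z o
  ∈-split⁺ {z} {o} {w} 0< (∣w∣ , refl , bal , pal)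
    with refl ← +-cancelʳ-≡ o ∣ w ∣[ 0F ] z (trans (∣∣+height w) ∣w∣) = by-first w refl
    where
    by-first : ∀ v → v ≡ w → w ∈ split z o
    -- The empty word has no first letter; `0<` excludes it.
    by-first []       refl = contradiction 0< λ ()
    by-first (0F ∷ _) refl = ∈-++⁺ˡ (∈-encodings⁺ (starting refl refl refl bal pal))
    by-first (1F ∷ _) refl = ∈-++⁺ʳ (encodings 0F z o) (∈-encodings⁺ (starting refl refl refl bal pal))

  ∈-split⁻ : ∀ {z o w} → w ∈ split z o → ℙ (z + o) o w
  ∈-split⁻ {z} {o} {w} w∈ with ∈-++⁻ (encodings 0F z o) w∈
  ... | inj₁ w∈₀ with starting _ refl refl bal pal ← ∈-encodings⁻ 0F z o w∈₀ =
    sym (∣∣+height w) , refl , bal , pal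
  ... | inj₂ w∈₁ with starting _ refl refl bal pal ← ∈-encodings⁻ 1F o z w∈₁ =
    sym (∣∣+height w) , refl , bal , pal

  split-unique : ∀ z o → Unique (split z o)
  split-unique z o = Unique.++⁺ (encodings-unique 0F z o) (encodings-unique 1F o z) λ (w∈₀ , w∈₁) →
    case trans (sym (Starting.begins (∈-encodings⁻ 0F z o w∈₀))) (Starting.begins (∈-encodings⁻ 1F o z w∈₁)) of λ ()

  -- Both lists are free of repetitions and have the same elements, hence are permutations of each
  -- other.
  #ℙ-split : ∀ z o → 0 < z + o → #ℙ (z + o) o ≡ length (encodings 0F z o) + length (encodings 1F o z)
  #ℙ-split z o 0< = trans
    (↭-length (∼bag⇒↭ (unique∧set⇒bag (ℙ-list-unique (z + o) o) (split-unique z o)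
      (mk⇔ (∈-split⁺ {z} 0< ∘ Equivalence.to ∈-ℙ-list) (Equivalence.from ∈-ℙ-list ∘ ∈-split⁻ {z})))))
    (length-++ (encodings 0F z o))

  -- As z > 0, the height is below the length, and the reduction modulo the length in `p` changes
  -- nothing.
  p-height : ∀ z o → 0 < z → p (ℤ.+ (z + o)) (ℤ.+ o) ≡ #ℙ (z + o) o
  p-height (suc z) o _ = cong (#ℙ (suc z + o)) (m<n⇒m%n≡m (s≤s (m≤n+m o z)))

  -- Here h = `suc o` and L - h = `suc z`: words beginning with 0 have `z` gaps of total `suc o`,
  -- those beginning with 1 have `o` gaps of total `suc z`.
  p-split : ∀ z o → p (ℤ.+ (suc z + suc o)) (ℤ.+ suc o) ≡ p (ℤ.+ z) (ℤ.+ suc o) + p (ℤ.+ o) (ℤ.+ suc z)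
  p-split z o = begin
    p (ℤ.+ (suc z + suc o)) (ℤ.+ suc o)  ≡⟨ p-height (suc z) (suc o) (s≤s z≤n) ⟩
    #ℙ (suc z + suc o) (suc o)           ≡⟨ #ℙ-split (suc z) (suc o) (s≤s z≤n) ⟩
    length (encodings 0F (suc z) (suc o)) + length (encodings 1F (suc o) (suc z))
      ≡⟨ cong₂ _+_ (length-encodings 0F z (suc o)) (length-encodings 1F o (suc z)) ⟩
    p (ℤ.+ z) (ℤ.+ suc o) + p (ℤ.+ o) (ℤ.+ suc z) ∎
    where open ≡-Reasoning

  -- No word of height 0 begins with 1, so only the first summand of `#ℙ-split` remains, and it
  -- leads from length `suc L` to `L`.
  p-zero : ∀ L → p (ℤ.+ L) (ℤ.+ 0) ≡ 1
  p-zero zero    = refl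
  p-zero (suc L) = begin
    p (ℤ.+ suc L) (ℤ.+ 0)                      ≡⟨ cong (λ n → p (ℤ.+ n) (ℤ.+ 0)) (+-identityʳ (suc L)) ⟨
    p (ℤ.+ (suc L + 0)) (ℤ.+ 0)                ≡⟨ p-height (suc L) 0 (s≤s z≤n) ⟩
    #ℙ (suc L + 0) 0                           ≡⟨ #ℙ-split (suc L) 0 (s≤s z≤n) ⟩
    length (encodings 0F (suc L) 0) + 0        ≡⟨ +-identityʳ _ ⟩
    length (encodings 0F (suc L) 0)            ≡⟨ length-encodings 0F L 0 ⟩
    p (ℤ.+ L) (ℤ.+ 0)                          ≡⟨ p-zero L ⟩
    1                                          ∎
    where open ≡-Reasoning

  p-% : ∀ L n .{{_ : NonZero L}} → p (ℤ.+ L) (ℤ.+ (L + n)) ≡ p (ℤ.+ L) (ℤ.+ n)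
  p-% L@(suc _) n = cong (#ℙ L) (trans (cong (_% L) (+-comm L n)) ([m+n]%n≡m%n n L))

open Words using (p-split; p-zero; p-%)
open import Defs
open import Data.Fin using (Fin; toℕ; zero; suc)
open import Data.Integer as ℤ using (+_; 0ℤ; 1ℤ)
import Data.Integer.Properties as ℤ
open import Data.Integer.Solver using (module +-*-Solver)
open import Data.Nat as ℕ using (ℕ; zero; suc; _≤_; _<_; z≤n; s≤s; _∸_)
import Data.Nat.Properties as ℕ
open import Data.Product using (_×_; _,_; ∃-syntax)
open import Data.Sum using (_⊎_; inj₁; inj₂)
open import Function using (_∘_)
open import Relation.Binary.PropositionalEquality
open +-*-Solver using (solve; _:=_; _:+_; _:*_; :-_; con)
open ≡-Reasoning

-- Arithmetic of formal power series

tail : PowerSeries → PowerSeries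
tail f = f ∘ suc

-- By definition (f * g) (suc n) = f 0 · g (suc n) + (tail f * g) n, so every law
-- of the product follows by induction on the coefficient, for all f at once.

*-cong : ∀ {f f′ g g′} → f ≈ f′ → g ≈ g′ → f * g ≈ f′ * g′
*-cong f≈ g≈ zero    = cong (ℤ._+ 0ℤ) (cong₂ ℤ._*_ (f≈ 0) (g≈ 0))
*-cong f≈ g≈ (suc n) = cong₂ ℤ._+_ (cong₂ ℤ._*_ (f≈ 0) (g≈ (suc n))) (*-cong (f≈ ∘ suc) g≈ n)

*-zeroˡ : ∀ g → 0# * g ≈ 0#
*-zeroˡ g zero    = refl
*-zeroˡ g (suc n) = trans (ℤ.+-identityˡ ((0# * g) n)) (*-zeroˡ g n)

*-identityˡ : ∀ g → 1# * g ≈ g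
*-identityˡ g zero    = trans (ℤ.+-identityʳ _) (ℤ.*-identityˡ (g 0))
*-identityˡ g (suc n) = begin
  1ℤ ℤ.* g (suc n) ℤ.+ (0# * g) n ≡⟨ cong₂ ℤ._+_ (ℤ.*-identityˡ (g (suc n))) (*-zeroˡ g n) ⟩
  g (suc n) ℤ.+ 0ℤ                ≡⟨ ℤ.+-identityʳ _ ⟩
  g (suc n)                       ∎

-- The mirror image of the defining recursion, with the summand at the other end split off; `*-comm`
-- plays the two against each other.
*-suc : ∀ f g n → (f * g) (suc n) ≡ f (suc n) ℤ.* g 0 ℤ.+ (f * tail g) n
*-suc f g zero    =
  solve 4 (λ a b c d → a :* b :+ (c :* d :+ con 0ℤ) := c :* d :+ (a :* b :+ con 0ℤ)) refl
    (f 0) (g 1) (f 1) (g 0)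
*-suc f g (suc n) = begin
  x ℤ.+ (tail f * g) (suc n)           ≡⟨ cong (ℤ._+_ x) (*-suc (tail f) g n) ⟩
  x ℤ.+ (y ℤ.+ (tail f * tail g) n)    ≡⟨ solve 3 (λ x y z → x :+ (y :+ z) := y :+ (x :+ z)) refl x y _ ⟩
  y ℤ.+ (x ℤ.+ (tail f * tail g) n)    ∎
  where
  x = f 0 ℤ.* g (suc (suc n))
  y = f (suc (suc n)) ℤ.* g 0

*-comm : ∀ f g → f * g ≈ g * f
*-comm f g zero    = cong (ℤ._+ 0ℤ) (ℤ.*-comm (f 0) (g 0))
*-comm f g (suc n) = begin
  f 0 ℤ.* g (suc n) ℤ.+ (tail f * g) n ≡⟨ cong₂ ℤ._+_ (ℤ.*-comm (f 0) (g (suc n))) (*-comm (tail f) g n) ⟩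
  g (suc n) ℤ.* f 0 ℤ.+ (g * tail f) n ≡⟨ *-suc g f n ⟨
  (g * f) (suc n)                      ∎

-- The combination has the shape that `tail (f * g)` takes in `*-assoc`; with `c = -1` it also
-- expands `1# - X ^ m`.
*-linearˡ : ∀ c f g h n → ((λ k → c ℤ.* f k ℤ.+ g k) * h) n ≡ c ℤ.* (f * h) n ℤ.+ (g * h) n
*-linearˡ c f g h zero    =
  solve 4 (λ c f g h → (c :* f :+ g) :* h :+ con 0ℤ := c :* (f :* h :+ con 0ℤ) :+ (g :* h :+ con 0ℤ)) refl
    c (f 0) (g 0) (h 0)
*-linearˡ c f g h (suc n) = begin
  (c ℤ.* f 0 ℤ.+ g 0) ℤ.* h (suc n) ℤ.+ ((λ k → c ℤ.* f (suc k) ℤ.+ g (suc k)) * h) n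
    ≡⟨ cong (ℤ._+_ ((c ℤ.* f 0 ℤ.+ g 0) ℤ.* h (suc n))) (*-linearˡ c (tail f) (tail g) h n) ⟩
  (c ℤ.* f 0 ℤ.+ g 0) ℤ.* h (suc n) ℤ.+ (c ℤ.* (tail f * h) n ℤ.+ (tail g * h) n)
    ≡⟨ solve 6 (λ c f g h x y → (c :* f :+ g) :* h :+ (c :* x :+ y) := c :* (f :* h :+ x) :+ (g :* h :+ y)) refl
         c (f 0) (g 0) (h (suc n)) ((tail f * h) n) ((tail g * h) n) ⟩
  c ℤ.* (f * h) (suc n) ℤ.+ (g * h) (suc n) ∎

*-assoc : ∀ f g h → (f * g) * h ≈ f * (g * h)
*-assoc f g h zero    =
  solve 3 (λ f g h → (f :* g :+ con 0ℤ) :* h :+ con 0ℤ := f :* (g :* h :+ con 0ℤ) :+ con 0ℤ) refl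
    (f 0) (g 0) (h 0)
*-assoc f g h (suc n) = begin
  (f 0 ℤ.* g 0 ℤ.+ 0ℤ) ℤ.* h (suc n) ℤ.+ ((λ k → f 0 ℤ.* tail g k ℤ.+ (tail f * g) k) * h) n
    ≡⟨ cong (ℤ._+_ ((f 0 ℤ.* g 0 ℤ.+ 0ℤ) ℤ.* h (suc n))) (*-linearˡ (f 0) (tail g) (tail f * g) h n) ⟩
  (f 0 ℤ.* g 0 ℤ.+ 0ℤ) ℤ.* h (suc n) ℤ.+ (f 0 ℤ.* (tail g * h) n ℤ.+ ((tail f * g) * h) n)
    ≡⟨ cong (λ x → (f 0 ℤ.* g 0 ℤ.+ 0ℤ) ℤ.* h (suc n) ℤ.+ (f 0 ℤ.* (tail g * h) n ℤ.+ x)) (*-assoc (tail f) g h n) ⟩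
  (f 0 ℤ.* g 0 ℤ.+ 0ℤ) ℤ.* h (suc n) ℤ.+ (f 0 ℤ.* (tail g * h) n ℤ.+ (tail f * (g * h)) n)
    ≡⟨ solve 5 (λ f g h x y → (f :* g :+ con 0ℤ) :* h :+ (f :* x :+ y) := f :* (g :* h :+ x) :+ y) refl
         (f 0) (g 0) (h (suc n)) ((tail g * h) n) ((tail f * (g * h)) n) ⟩
  f 0 ℤ.* (g * h) (suc n) ℤ.+ (tail f * (g * h)) n ∎

-- Constant term 1 makes `g ⁻¹` a genuine inverse, so f = f (g g⁻¹) = h g⁻¹. Each claimed quotient
-- is thereby reduced to an identity without that division.
divide : ∀ f g {h} → g 0 ≡ 1ℤ → f * g ≈ h → f ≈ h / g
divide f g {h} g₀≡1 f*g≈h n = begin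
  f n                  ≡⟨ *-identityˡ f n ⟨
  (1# * f) n           ≡⟨ *-comm 1# f n ⟩
  (f * 1#) n           ≡⟨ *-cong {f} (λ _ → refl) (*-inverseʳ g g₀≡1) n ⟨
  (f * (g * g ⁻¹)) n   ≡⟨ *-assoc f g (g ⁻¹) n ⟨
  ((f * g) * g ⁻¹) n   ≡⟨ *-cong {g = g ⁻¹} f*g≈h (λ _ → refl) n ⟩
  (h / g) n            ∎

-- Multiplication by powers of X and by 1 - X^m

X*-suc : ∀ f n → (X * f) (suc n) ≡ f n
X*-suc f n = begin
  0ℤ ℤ.* f (suc n) ℤ.+ (tail X * f) n ≡⟨ ℤ.+-identityˡ _ ⟩
  (tail X * f) n                      ≡⟨ *-cong {g = f} tail-X (λ _ → refl) n ⟩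
  (1# * f) n                          ≡⟨ *-identityˡ f n ⟩
  f n                                 ∎
  where
  tail-X : tail X ≈ 1#
  tail-X zero    = refl
  tail-X (suc n) = refl

X^*-< : ∀ m f {n} → n < m → ((X ^ m) * f) n ≡ 0ℤ
-- The right-hand side of associativity computes to `0ℤ`, since `X` has constant term 0.
X^*-< (suc m) f {zero}  _         = *-assoc X (X ^ m) f 0
X^*-< (suc m) f {suc n} (s≤s n<m) = begin
  ((X * X ^ m) * f) (suc n) ≡⟨ *-assoc X (X ^ m) f (suc n) ⟩
  (X * (X ^ m * f)) (suc n) ≡⟨ X*-suc (X ^ m * f) n ⟩
  (X ^ m * f) n             ≡⟨ X^*-< m f n<m ⟩
  0ℤ                        ∎

X^*-+ : ∀ m f n → ((X ^ m) * f) (m ℕ.+ n) ≡ f n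
X^*-+ zero    f n = *-identityˡ f n
X^*-+ (suc m) f n = begin
  ((X * X ^ m) * f) (suc (m ℕ.+ n)) ≡⟨ *-assoc X (X ^ m) f (suc (m ℕ.+ n)) ⟩
  (X * (X ^ m * f)) (suc (m ℕ.+ n)) ≡⟨ X*-suc (X ^ m * f) (m ℕ.+ n) ⟩
  (X ^ m * f) (m ℕ.+ n)             ≡⟨ X^*-+ m f n ⟩
  f n                               ∎

*-[1-X^] : ∀ f m n → (f * (1# - X ^ m)) n ≡ f n ℤ.- ((X ^ m) * f) n
*-[1-X^] f m n = begin
  (f * (1# - X ^ m)) n                             ≡⟨ *-comm f (1# - X ^ m) n ⟩
  ((1# - X ^ m) * f) n                             ≡⟨ *-cong {g = f} swap (λ _ → refl) n ⟩
  ((λ k → ℤ.-1ℤ ℤ.* (X ^ m) k ℤ.+ 1# k) * f) n     ≡⟨ *-linearˡ ℤ.-1ℤ (X ^ m) 1# f n ⟩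
  ℤ.-1ℤ ℤ.* ((X ^ m) * f) n ℤ.+ (1# * f) n         ≡⟨ cong (ℤ._+_ (ℤ.-1ℤ ℤ.* ((X ^ m) * f) n)) (*-identityˡ f n) ⟩
  ℤ.-1ℤ ℤ.* ((X ^ m) * f) n ℤ.+ f n
    ≡⟨ solve 2 (λ x y → con ℤ.-1ℤ :* x :+ y := y :+ :- x) refl (((X ^ m) * f) n) (f n) ⟩
  f n ℤ.- ((X ^ m) * f) n                          ∎
  where
  swap : 1# - X ^ m ≈ λ k → ℤ.-1ℤ ℤ.* (X ^ m) k ℤ.+ 1# k
  swap k = solve 2 (λ x y → x :+ :- y := con ℤ.-1ℤ :* y :+ x) refl (1# k) ((X ^ m) k)

*-[1-X^]-< : ∀ f m {n} → n < m → (f * (1# - X ^ m)) n ≡ f n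
*-[1-X^]-< f m {n} n<m = begin
  (f * (1# - X ^ m)) n         ≡⟨ *-[1-X^] f m n ⟩
  f n ℤ.- ((X ^ m) * f) n      ≡⟨ cong (λ x → f n ℤ.- x) (X^*-< m f n<m) ⟩
  f n ℤ.- 0ℤ                   ≡⟨ ℤ.+-identityʳ (f n) ⟩
  f n                          ∎

*-[1-X^]-+ : ∀ f m n → (f * (1# - X ^ m)) (m ℕ.+ n) ≡ f (m ℕ.+ n) ℤ.- f n
*-[1-X^]-+ f m n = trans (*-[1-X^] f m (m ℕ.+ n)) (cong (λ x → f (m ℕ.+ n) ℤ.- x) (X^*-+ m f n))

≤-view : ∀ m n → n < m ⊎ ∃[ j ] n ≡ m ℕ.+ j
≤-view m n with ℕ.<-≤-connex n m
... | inj₁ n<m = inj₁ n<m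
... | inj₂ m≤n = inj₂ (n ∸ m , sym (ℕ.m+[n∸m]≡n m≤n))

-- Coefficients of the finite sums

polynomial : ∀ h → (ℕ → ℕ) → PowerSeries
polynomial h c = ∑[ L < h ] (c (toℕ L) · X ^ toℕ L)

·-coefficient : ∀ c f n → (c · f) n ≡ + c ℤ.* f n
·-coefficient zero    f n = refl
·-coefficient (suc c) f n = begin
  f n ℤ.+ (c · f) n    ≡⟨ cong (ℤ._+_ (f n)) (·-coefficient c f n) ⟩
  f n ℤ.+ + c ℤ.* f n  ≡⟨ ℤ.suc-* (+ c) (f n) ⟨
  + suc c ℤ.* f n      ∎

∑-coefficient : ∀ h (t : Fin h → PowerSeries) n → (∑[ i < h ] t i) n ≡ ℤ-Sum.sum λ i → t i n
∑-coefficient zero    t n = refl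
∑-coefficient (suc h) t n = cong (ℤ._+_ (t zero n)) (∑-coefficient h (t ∘ suc) n)

∑-zero : ∀ h {t : Fin h → ℤ.ℤ} → (∀ i → t i ≡ 0ℤ) → ℤ-Sum.sum t ≡ 0ℤ
∑-zero zero    t≡0 = refl
∑-zero (suc h) t≡0 = cong₂ ℤ._+_ (t≡0 zero) (∑-zero h (t≡0 ∘ suc))

polynomial-zero : ∀ h c → polynomial (suc h) c 0 ≡ + c 0
polynomial-zero h c = begin
  polynomial (suc h) c 0  ≡⟨ ∑-coefficient (suc h) (λ L → c (toℕ L) · X ^ toℕ L) 0 ⟩
  (c 0 · 1#) 0 ℤ.+ ℤ-Sum.sum (λ i → (c (suc (toℕ {h} i)) · (X * X ^ toℕ i)) 0)
    ≡⟨ cong₂ ℤ._+_ (·-coefficient (c 0) 1# 0) (∑-zero h λ i →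
         trans (·-coefficient (c (suc (toℕ i))) (X * X ^ toℕ i) 0) (ℤ.*-zeroʳ (+ c (suc (toℕ i))))) ⟩
  + c 0 ℤ.* 1ℤ ℤ.+ 0ℤ     ≡⟨ solve 1 (λ x → x :* con 1ℤ :+ con 0ℤ := x) refl (+ c 0) ⟩
  + c 0                   ∎

-- Dropping the constant term and dividing by X shifts the coefficients; `polynomial-<` and
-- `polynomial-+` follow by induction.
polynomial-suc : ∀ h c n → polynomial (suc h) c (suc n) ≡ polynomial h (c ∘ suc) n
polynomial-suc h c n = begin
  polynomial (suc h) c (suc n)  ≡⟨ ∑-coefficient (suc h) (λ L → c (toℕ L) · X ^ toℕ L) (suc n) ⟩
  (c 0 · 1#) (suc n) ℤ.+ ℤ-Sum.sum (λ i → (c (suc (toℕ {h} i)) · (X * X ^ toℕ i)) (suc n))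
    ≡⟨ cong₂ ℤ._+_ (trans (·-coefficient (c 0) 1# (suc n)) (ℤ.*-zeroʳ (+ c 0))) (ℤ-Sum.sum-cong-≗ shift) ⟩
  0ℤ ℤ.+ ℤ-Sum.sum (λ i → (c (suc (toℕ {h} i)) · X ^ toℕ i) n)  ≡⟨ ℤ.+-identityˡ _ ⟩
  ℤ-Sum.sum (λ i → (c (suc (toℕ {h} i)) · X ^ toℕ i) n)         ≡⟨ ∑-coefficient h _ n ⟨
  polynomial h (c ∘ suc) n                                      ∎
  where
  shift : ∀ i → (c (suc (toℕ {h} i)) · (X * X ^ toℕ i)) (suc n) ≡ (c (suc (toℕ i)) · X ^ toℕ i) n
  shift i = begin
    (cᵢ · (X * X ^ toℕ i)) (suc n)     ≡⟨ ·-coefficient cᵢ (X * X ^ toℕ i) (suc n) ⟩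
    + cᵢ ℤ.* (X * X ^ toℕ i) (suc n)   ≡⟨ cong (+ cᵢ ℤ.*_) (X*-suc (X ^ toℕ i) n) ⟩
    + cᵢ ℤ.* (X ^ toℕ i) n             ≡⟨ ·-coefficient cᵢ (X ^ toℕ i) n ⟨
    (cᵢ · X ^ toℕ i) n                 ∎
    where cᵢ = c (suc (toℕ i))

polynomial-< : ∀ h c {n} → n < h → polynomial h c n ≡ + c n
polynomial-< (suc h) c {zero}  _         = polynomial-zero h c
polynomial-< (suc h) c {suc n} (s≤s n<h) = trans (polynomial-suc h c n) (polynomial-< h (c ∘ suc) n<h)

polynomial-+ : ∀ h c n → polynomial h c (h ℕ.+ n) ≡ 0ℤ
polynomial-+ zero    c n = refl
polynomial-+ (suc h) c n = trans (polynomial-suc h c (h ℕ.+ n)) (polynomial-+ h (c ∘ suc) n)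

-- The generating functions

-- Heights count modulo the length, so p(h,h) = p(h,0). This supplies the coefficient at L = h,
-- which the recurrence does not reach.
p-diagonal : ∀ o → p (+ suc o) (+ suc o) ≡ 1
p-diagonal o = begin
  p (+ suc o) (+ suc o)          ≡⟨ cong (λ n → p (+ suc o) (+ n)) (ℕ.+-identityʳ (suc o)) ⟨
  p (+ suc o) (+ (suc o ℕ.+ 0))  ≡⟨ p-% (suc o) 0 ⟩
  p (+ suc o) (+ 0)              ≡⟨ p-zero (suc o) ⟩
  1                              ∎

-- For h = `suc o` the left side is a coefficient of (1 - X^(h+1)) times `𝒫 h`. By `p-split` at L =
-- h + 1 + i, the subtracted term cancels p(L-h-1,h).
𝒫-recurrence : ∀ o i → 𝒫 (suc o) (suc (suc o) ℕ.+ i) ℤ.- 𝒫 (suc o) i ≡ + p (+ o) (+ suc i)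
𝒫-recurrence o i = begin
  𝒫 (suc o) (suc (suc o) ℕ.+ i) ℤ.- 𝒫 (suc o) i
    ≡⟨ cong (λ n → 𝒫 (suc o) (suc n) ℤ.- 𝒫 (suc o) i) (ℕ.+-comm (suc o) i) ⟩
  + p (+ (suc i ℕ.+ suc o)) (+ suc o) ℤ.- 𝒫 (suc o) i
    ≡⟨ cong (λ n → + n ℤ.- 𝒫 (suc o) i) (p-split i o) ⟩
  + (p (+ i) (+ suc o) ℕ.+ p (+ o) (+ suc i)) ℤ.- + p (+ i) (+ suc o)
    ≡⟨ cong (ℤ._- + p (+ i) (+ suc o)) (ℤ.pos-+ (p (+ i) (+ suc o)) _) ⟩
  (+ p (+ i) (+ suc o) ℤ.+ + p (+ o) (+ suc i)) ℤ.- + p (+ i) (+ suc o)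
    ≡⟨ solve 2 (λ x y → x :+ y :+ :- x := y) refl (+ p (+ i) (+ suc o)) (+ p (+ o) (+ suc i)) ⟩
  + p (+ o) (+ suc i) ∎

-- By `p-%` the coefficients have period `suc k`, so multiplying by `1# - X ^ suc k` leaves only the
-- first period.
period : ∀ k → (λ n → + p (+ suc k) (+ n)) ≈
               polynomial (suc k) (λ r → p (+ suc k) (+ r)) / (1# - X ^ suc k)
period k = divide S (1# - X ^ suc k) refl numerator
  where
  S : PowerSeries
  S n = + p (+ suc k) (+ n)
  c : ℕ → ℕ
  c r = p (+ suc k) (+ r)
  numerator : S * (1# - X ^ suc k) ≈ polynomial (suc k) c
  numerator n with ≤-view (suc k) n
  ... | inj₁ n<       = trans (*-[1-X^]-< S (suc k) n<) (sym (polynomial-< (suc k) c n<))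
  ... | inj₂ (j , refl) = begin
    (S * (1# - X ^ suc k)) (suc k ℕ.+ j)  ≡⟨ *-[1-X^]-+ S (suc k) j ⟩
    S (suc k ℕ.+ j) ℤ.- S j               ≡⟨ cong (λ x → + x ℤ.- S j) (p-% (suc k) j) ⟩
    S j ℤ.- S j                           ≡⟨ ℤ.+-inverseʳ (S j) ⟩
    0ℤ                                    ≡⟨ polynomial-+ (suc k) c j ⟨
    polynomial (suc k) c (suc k ℕ.+ j)    ∎

𝒫₀ : 𝒫 0 ≈ 1# / (1# - X)
𝒫₀ = divide (𝒫 0) (1# - X) refl numerator
  where
  -- `X ^ 1` unfolds to `X * 1#`, which is not `X` by computation, while the lemmas on `1# - X ^ m`
  -- need a power.
  X≈X^1 : X ≈ X ^ 1
  X≈X^1 n = sym (trans (*-comm X 1# n) (*-identityˡ X n))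
  numerator : 𝒫 0 * (1# - X) ≈ 1#
  numerator n = trans (*-cong {𝒫 0} (λ _ → refl) (λ k → cong (λ x → 1# k ℤ.- x) (X≈X^1 k)) n) (coefficient n)
    where
    coefficient : 𝒫 0 * (1# - X ^ 1) ≈ 1#
    coefficient zero    = refl
    coefficient (suc n) = begin
      (𝒫 0 * (1# - X ^ 1)) (suc n) ≡⟨ *-[1-X^]-+ (𝒫 0) 1 n ⟩
      𝒫 0 (suc n) ℤ.- 𝒫 0 n        ≡⟨ cong₂ (λ x y → + x ℤ.- + y) (p-zero (suc n)) (p-zero n) ⟩
      0ℤ                           ∎

𝒫₁ : 𝒫 1 ≈ X / (1# - X ^ 2)
𝒫₁ = divide (𝒫 1) (1# - X ^ 2) refl numerator
  where
  numerator : 𝒫 1 * (1# - X ^ 2) ≈ X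
  -- The values p(0,1) = 0 and p(1,1) = p(1,0) = 1 are obtained by evaluation.
  numerator 0 = *-[1-X^]-< (𝒫 1) 2 (s≤s z≤n)
  numerator 1 = *-[1-X^]-< (𝒫 1) 2 (s≤s (s≤s z≤n))
  -- The recurrence leaves p(0,n+1), which is 0.
  numerator (suc (suc n)) = trans (*-[1-X^]-+ (𝒫 1) 2 n) (𝒫-recurrence 0 n)

-- After multiplication by 1 - X^(h+1), the coefficients below degree h are still those of `𝒫 h`,
-- and the one at h + j is p(h-1,j). The latter form X^h times the periodic series `S`, which
-- `period` rewrites as a quotient.
𝒫ₕ : ∀ h → 2 ≤ h →
      𝒫 h ≈ (1# / (1# - X ^ (h ℕ.+ 1))) *
            ((∑[ L < h ] (p (+ toℕ L) (+ h) · X ^ toℕ L)) +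
             (X ^ h / (1# - X ^ (h ∸ 1))) *
             (∑[ r < h ∸ 1 ] (p (+ (h ∸ 1)) (+ toℕ r) · X ^ toℕ r)))
𝒫ₕ 1 (s≤s ())
𝒫ₕ h@(suc o@(suc k)) _ n = begin
  𝒫 h n                              ≡⟨ divide (𝒫 h) D refl numerator n ⟩
  ((A + X ^ h * S) * D ⁻¹) n         ≡⟨ *-comm (A + X ^ h * S) (D ⁻¹) n ⟩
  (D ⁻¹ * (A + X ^ h * S)) n
    ≡⟨ *-cong (λ i → sym (*-identityˡ (D ⁻¹) i)) (λ i → cong (ℤ._+_ (A i)) (X^h*S i)) n ⟩
  ((1# / D) * (A + (X ^ h / E) * C)) n ∎
  where
  D = 1# - X ^ (h ℕ.+ 1)
  E = 1# - X ^ o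
  a : ℕ → ℕ
  a L = p (+ L) (+ h)
  A = polynomial h a
  C = polynomial o (λ r → p (+ o) (+ r))
  S : PowerSeries
  S r = + p (+ o) (+ r)
  X^h*S : X ^ h * S ≈ (X ^ h / E) * C
  X^h*S i = begin
    (X ^ h * S) i            ≡⟨ *-cong {X ^ h} (λ _ → refl) (period k) i ⟩
    (X ^ h * (C * E ⁻¹)) i   ≡⟨ *-cong {X ^ h} (λ _ → refl) (*-comm C (E ⁻¹)) i ⟩
    (X ^ h * (E ⁻¹ * C)) i   ≡⟨ *-assoc (X ^ h) (E ⁻¹) C i ⟨
    ((X ^ h * E ⁻¹) * C) i   ∎
  numerator : 𝒫 h * D ≈ A + X ^ h * S
  numerator n with ≤-view h n
  ... | inj₁ n<h = begin
    (𝒫 h * D) n               ≡⟨ *-[1-X^]-< (𝒫 h) (h ℕ.+ 1) (ℕ.<-≤-trans n<h (ℕ.m≤m+n h 1)) ⟩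
    𝒫 h n                     ≡⟨ ℤ.+-identityʳ (𝒫 h n) ⟨
    𝒫 h n ℤ.+ 0ℤ              ≡⟨ cong₂ ℤ._+_ (polynomial-< h a n<h) (X^*-< h S n<h) ⟨
    A n ℤ.+ (X ^ h * S) n     ∎
  ... | inj₂ (j , refl) = begin
    (𝒫 h * D) (h ℕ.+ j)                   ≡⟨ coefficient j ⟩
    S j                                   ≡⟨ ℤ.+-identityˡ (S j) ⟨
    0ℤ ℤ.+ S j                            ≡⟨ cong₂ ℤ._+_ (polynomial-+ h a j) (X^*-+ h S j) ⟨
    A (h ℕ.+ j) ℤ.+ (X ^ h * S) (h ℕ.+ j) ∎
    where
    coefficient : ∀ j → (𝒫 h * D) (h ℕ.+ j) ≡ S j
    -- Degree h is still below h + 1, so nothing is subtracted; both p(h,h) and p(h-1,0) are 1.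
    coefficient zero = begin
      (𝒫 h * D) (h ℕ.+ 0)  ≡⟨ *-[1-X^]-< (𝒫 h) (h ℕ.+ 1) (ℕ.+-monoʳ-< h (s≤s z≤n)) ⟩
      𝒫 h (h ℕ.+ 0)        ≡⟨ cong (𝒫 h) (ℕ.+-identityʳ h) ⟩
      𝒫 h h                ≡⟨ cong +_ (p-diagonal o) ⟩
      1ℤ                   ≡⟨ cong +_ (p-zero o) ⟨
      S 0                  ∎
    coefficient (suc i) = begin
      (𝒫 h * D) (h ℕ.+ suc i)                ≡⟨ cong (𝒫 h * D) (ℕ.+-assoc h 1 i) ⟨
      (𝒫 h * D) (h ℕ.+ 1 ℕ.+ i)              ≡⟨ *-[1-X^]-+ (𝒫 h) (h ℕ.+ 1) i ⟩
      𝒫 h (h ℕ.+ 1 ℕ.+ i) ℤ.- 𝒫 h i          ≡⟨ cong (λ m → 𝒫 h (m ℕ.+ i) ℤ.- 𝒫 h i) (ℕ.+-comm h 1) ⟩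
      𝒫 h (suc h ℕ.+ i) ℤ.- 𝒫 h i            ≡⟨ 𝒫-recurrence o i ⟩
      S (suc i)                              ∎

theorem21 : (𝒫 0 ≈ 1# / (1# - X)) ×
    (𝒫 1 ≈ X / (1# - X ^ 2)) ×
    (∀ (h : ℕ) → 2 ≤ h →
    𝒫 h ≈ (1# / (1# - X ^ (h ℕ.+ 1))) *
    ((∑[ L < h ] (p (+ toℕ L) (+ h) · X ^ toℕ L)) +
    (X ^ h / (1# - X ^ (h ∸ 1))) *
    (∑[ r < h ∸ 1 ] (p (+ (h ∸ 1)) (+ toℕ r) · X ^ toℕ r))))
theorem21 = 𝒫₀ , 𝒫₁ , 𝒫ₕ
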